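{- Let $(\alpha,\beta)=(\alpha_0,\beta_0)\in\Delta_K$, $(\alpha_n,\beta_n)=T^n(\alpha,\beta)$, and $n\in\mathbb{Z}_{\ge0}$. Write $\varepsilon(\alpha_n,\beta_n)=(i',j')$ and let $k\in\{0,1,2\}$ be the unique element with $k\ne i'$, $k\ne j'$. Then $\varepsilon(\alpha_{n+1},\beta_{n+1})\neq(i',k)$ and $\varepsilon(\alpha_{n+1},\beta_{n+1})\neq(k,i')$. (Equivalently, the following 12 two-letter words never occur as $\varepsilon(\alpha_n,\beta_n)\varepsilon(\alpha_{n+1},\beta_{n+1})$: $(1,2)$ followed by $(0,1)$ or $(1,0)$; $(2,1)$ followed by $(0,2)$ or $(2,0)$; $(0,1)$ followed by $(0,2)$ or $(2,0)$; $(1,0)$ followed by $(1,2)$ or $(2,1)$; $(0,2)$ followed by $(0,1)$ or $(1,0)$; $(2,0)$ followed by $(1,2)$ or $(2,1)$.)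
   Context: Let $K\subset\mathbb{R}$ be a real cubic number field, $N=N_{K/\mathbb{Q}}$ its norm. Fix $r=p/q$ with $p,q$ positive coprime integers and $3\nmid p$. Let $\Delta_K=\{(\alpha,\beta)\in K^2:\ 1,\alpha,\beta \text{ linearly independent over }\mathbb{Q},\ \alpha,\beta>0,\ \alpha+\beta<1\}$ and $Ind=\{(i,j): i,j\in\{0,1,2\},\ i\neq j\}$. Let $\Delta=\{(x,y)\in\mathbb{R}^2: x,y\ge 0,\ x+y\le 1\}$ and $\triangle(1,2)=\{(x,y)\in\Delta: x\ge y\}$, $\triangle(2,1)=\{x\le y\}$, $\triangle(0,1)=\{2x+y-1\le 0\}$, $\triangle(1,0)=\{2x+y-1\ge 0\}$, $\triangle(0,2)=\{x+2y-1\le0\}$, $\triangle(2,0)=\{x+2y-1\ge 0\}$ (all subsets of $\Delta$). Maps $T_{(i,j)}:\triangle(i,j)\to\Delta$: $T_{(1,2)}(x,y)=(\frac{x-y}{1-y},\frac{y}{1-y})$, $T_{(2,1)}(x,y)=(\frac{x}{1-x},\frac{y-x}{1-x})$, $T_{(0,1)}(x,y)=(\frac{x}{1-x},\frac{y}{1-x})$, $T_{(1,0)}(x,y)=(\frac{2x+y-1}{x+y},\frac{y}{x+y})$, $T_{(0,2)}(x,y)=(\frac{x}{1-y},\frac{y}{1-y})$, $T_{(2,0)}(x,y)=(\frac{x}{x+y},\frac{x+2y-1}{x+y})$. For $(\alpha,\beta)\in\Delta_K$ put $\gamma=1-\alpha-\beta$ and $v_{\{1,2\}}=\frac{\alpha^r\beta^r}{|N(\alpha)N(\beta)|}$,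 $v_{\{0,1\}}=\frac{\alpha^r\gamma^r}{|N(\alpha)N(\gamma)|}$, $v_{\{0,2\}}=\frac{\beta^r\gamma^r}{|N(\beta)N(\gamma)|}$; the maximum is attained at a unique pair $\{i_0,j_0\}$. $\varepsilon(\alpha,\beta)$ is the ordered pair $(i,j)\in Ind$ with $\{i,j\}=\{i_0,j_0\}$ and $(\alpha,\beta)\in\triangle(i,j)$, and $T(\alpha,\beta)=T_{\varepsilon(\alpha,\beta)}(\alpha,\beta)$ (a map $\Delta_K\to\Delta_K$). -}

module Defs where

open import Level using (Level; _⊔_) renaming (suc to lsuc)
open import Algebra.Apartness.Bundles using (HeytingField; HeytingCommutativeRing)
open import Algebra.Bundles using (CommutativeRing)
open import Algebra.Morphism.Structures using (module RingMorphisms)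
open import Data.Fin.Base using (Fin)
open import Data.Fin.Patterns using (0F; 1F; 2F)
open import Data.Nat.Base as ℕ using (ℕ)
open import Data.Product.Base using (Σ; ∃; ∃-syntax; _×_; _,_; proj₁; proj₂; map)
open import Data.Rational.Base as ℚ using (ℚ; 0ℚ)
open import Data.Sum.Base using (_⊎_)
open import Data.Vec.Functional using (Vector; []; _∷_)
open import Function.Bundles using (_⇔_)
open import Relation.Binary.Core using (Rel)
open import Relation.Binary.PropositionalEquality.Core as ≡ using (_≡_; _≢_)
open import Relation.Binary.Structures using (IsStrictPartialOrder)
open import Relation.Nullary.Negation using (¬_; contradiction)
open import Relation.Unary using (Pred)
import Algebra.Properties.CommutativeMonoid.Sum as Summation
import Algebra.Properties.Semiring.Exp as Exponentiation

-- The real numbers, axiomatised as a Cauchy complete archimedean ordered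
-- field.  Classically such a structure is unique up to unique isomorphism;
-- apartness and cotransitivity replace the decidability of the order, so that
-- constructively defined reals are models as well.
record RealNumbers (c ℓ₁ ℓ₂ : Level) : Set (lsuc (c ⊔ ℓ₁ ⊔ ℓ₂)) where
  field
    heytingField : HeytingField c ℓ₁ ℓ₂

  open HeytingField heytingField public

  commutativeRing : CommutativeRing c ℓ₁
  commutativeRing =
    HeytingCommutativeRing.commutativeRing
      (HeytingField.heytingCommutativeRing heytingField)

  open CommutativeRing commutativeRing public
    using (rawRing; semiring; +-commutativeMonoid)

  infix 4 _<_ _≤_

  field
    _<_                  : Rel Carrier ℓ₂
    isStrictPartialOrder : IsStrictPartialOrder _≈_ _<_
    #⇔<⊎>                : ∀ {x y} → x # y ⇔ (x < y ⊎ y < x)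
    +-monoˡ-<            : ∀ {x y} z → x < y → x + z < y + z
    *-pos                : ∀ {x y} → 0# < x → 0# < y → 0# < x * y

  _≤_ : Rel Carrier ℓ₂
  x ≤ y = ¬ (y < x)

  field
    ι                    : ℚ → Carrier
    ι-isRingHomomorphism :
      RingMorphisms.IsRingHomomorphism ℚ.+-*-rawRing rawRing ι
    ι-mono-<             : ∀ {a b} → a ℚ.< b → ι a < ι b
    archimedean          : ∀ {x y} → x < y → ∃[ a ] x < ι a × ι a < y

  Within : ℚ → Carrier → Carrier → Set ℓ₂
  Within δ x y = x < y + ι δ × y < x + ι δ

  Cauchy : (ℕ → Carrier) → Set ℓ₂
  Cauchy s = ∀ δ → 0ℚ ℚ.< δ →
    ∃[ M ] ∀ m n → M ℕ.≤ m → M ℕ.≤ n → Within δ (s m) (s n)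

  _ConvergesTo_ : (ℕ → Carrier) → Carrier → Set ℓ₂
  s ConvergesTo x = ∀ δ → 0ℚ ℚ.< δ →
    ∃[ M ] ∀ m → M ℕ.≤ m → Within δ (s m) x

  field
    complete : ∀ s → Cauchy s → ∃[ x ] s ConvergesTo x

  open Exponentiation semiring public using (_^_)

  infix 4 _≈[_/_] _^[_/_]≈_

  -- "z is the quotient x / y"
  _≈[_/_] : Carrier → Carrier → Carrier → Set (ℓ₁ ⊔ ℓ₂)
  z ≈[ x / y ] = y # 0# × z * y ≈ x

  -- "x raised to the real power p / q is y": the base is positive, and y is
  -- the positive q-th root of x ^ p.
  _^[_/_]≈_ : Carrier → ℕ → ℕ → Carrier → Set (ℓ₁ ⊔ ℓ₂)
  x ^[ p / q ]≈ y = 0# < x × 0# < y × y ^ q ≈ x ^ p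

  combination : ∀ {n} → Vector ℚ n → Vector Carrier n → Carrier
  combination a v = Summation.sum +-commutativeMonoid (λ i → ι (a i) * v i)

  LinearlyIndependent : ∀ {n} → Vector Carrier n → Set ℓ₁
  LinearlyIndependent v = ∀ a → combination a v ≈ 0# → ∀ i → a i ≡ 0ℚ

-- A subfield of ℝ together with a ℚ-basis of length three.
record RealCubicField {c ℓ₁ ℓ₂} (ℝ : RealNumbers c ℓ₁ ℓ₂) (ℓ : Level)
       : Set (c ⊔ ℓ₁ ⊔ ℓ₂ ⊔ lsuc ℓ) where
  open RealNumbers ℝ

  infix 4 _∈K

  field
    _∈K              : Pred Carrier ℓ
    ∈K-resp-≈        : ∀ {x y} → x ≈ y → x ∈K → y ∈K
    0∈K              : 0# ∈K
    1∈K              : 1# ∈K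
    +-closed         : ∀ {x y} → x ∈K → y ∈K → x + y ∈K
    -‿closed         : ∀ {x} → x ∈K → - x ∈K
    *-closed         : ∀ {x y} → x ∈K → y ∈K → x * y ∈K
    inverse          : ∀ {x} → x ∈K → ¬ (x ≈ 0#) → ∃[ y ] y ∈K × x * y ≈ 1#
    basis            : Vector Carrier 3
    basis∈K          : ∀ i → basis i ∈K
    basisIndependent : LinearlyIndependent basis
    coordinates      : ∀ {x} → x ∈K → Vector ℚ 3
    basisSpans       : ∀ {x} (x∈K : x ∈K) →
                       x ≈ combination (coordinates x∈K) basis

  K : Set (c ⊔ ℓ)
  K = ∃ _∈K

  -- Column j holds the coordinates of x * basis j.
  multiplicationMatrix : K → Fin 3 → Fin 3 → ℚ
  multiplicationMatrix (_ , x∈K) i j =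
    coordinates (*-closed x∈K (basis∈K j)) i

det₃ : (Fin 3 → Fin 3 → ℚ) → ℚ
det₃ m =
  m 0F 0F ℚ.* (m 1F 1F ℚ.* m 2F 2F ℚ.- m 1F 2F ℚ.* m 2F 1F)
    ℚ.- m 0F 1F ℚ.* (m 1F 0F ℚ.* m 2F 2F ℚ.- m 1F 2F ℚ.* m 2F 0F)
    ℚ.+ m 0F 2F ℚ.* (m 1F 0F ℚ.* m 2F 1F ℚ.- m 1F 1F ℚ.* m 2F 0F)

Ind : Set
Ind = Σ (Fin 3 × Fin 3) λ (i , j) → i ≢ j

SamePair : Ind → Ind → Set
SamePair ((i , j) , _) ((k , l) , _) = (i ≡ k × j ≡ l) ⊎ (i ≡ l × j ≡ k)

module Triangles {c ℓ₁ ℓ₂} (ℝ : RealNumbers c ℓ₁ ℓ₂) where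
  open RealNumbers ℝ

  2# : Carrier
  2# = 1# + 1#

  Δ : Pred (Carrier × Carrier) ℓ₂
  Δ (x , y) = 0# ≤ x × 0# ≤ y × x + y ≤ 1#

  half : Ind → Pred (Carrier × Carrier) ℓ₂
  half ((1F , 2F) , _) (x , y) = y ≤ x
  half ((2F , 1F) , _) (x , y) = x ≤ y
  half ((0F , 1F) , _) (x , y) = (2# * x + y) - 1# ≤ 0#
  half ((1F , 0F) , _) (x , y) = 0# ≤ (2# * x + y) - 1#
  half ((0F , 2F) , _) (x , y) = (x + 2# * y) - 1# ≤ 0#
  half ((2F , 0F) , _) (x , y) = 0# ≤ (x + 2# * y) - 1#
  half ((0F , 0F) , i≢j) = contradiction ≡.refl i≢j
  half ((1F , 1F) , i≢j) = contradiction ≡.refl i≢j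
  half ((2F , 2F) , i≢j) = contradiction ≡.refl i≢j

  △ : Ind → Pred (Carrier × Carrier) ℓ₂
  △ e z = Δ z × half e z

  -- Graph of the map T_(i,j) : △ (i , j) → Δ.
  Tᵢⱼ : Ind → Carrier × Carrier → Carrier × Carrier → Set (ℓ₁ ⊔ ℓ₂)
  Tᵢⱼ e z z′ = △ e z × formula e z z′
    where
    formula : Ind → Carrier × Carrier → Carrier × Carrier → Set (ℓ₁ ⊔ ℓ₂)
    formula ((1F , 2F) , _) (x , y) (x′ , y′) =
      x′ ≈[ x - y / 1# - y ] × y′ ≈[ y / 1# - y ]
    formula ((2F , 1F) , _) (x , y) (x′ , y′) =
      x′ ≈[ x / 1# - x ] × y′ ≈[ y - x / 1# - x ]
    formula ((0F , 1F) , _) (x , y) (x′ , y′) =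
      x′ ≈[ x / 1# - x ] × y′ ≈[ y / 1# - x ]
    formula ((1F , 0F) , _) (x , y) (x′ , y′) =
      x′ ≈[ (2# * x + y) - 1# / x + y ] × y′ ≈[ y / x + y ]
    formula ((0F , 2F) , _) (x , y) (x′ , y′) =
      x′ ≈[ x / 1# - y ] × y′ ≈[ y / 1# - y ]
    formula ((2F , 0F) , _) (x , y) (x′ , y′) =
      x′ ≈[ x / x + y ] × y′ ≈[ (x + 2# * y) - 1# / x + y ]
    formula ((0F , 0F) , i≢j) = contradiction ≡.refl i≢j
    formula ((1F , 1F) , i≢j) = contradiction ≡.refl i≢j
    formula ((2F , 2F) , i≢j) = contradiction ≡.refl i≢j

-- The algorithm for the field K and the exponent r = p / q.
module Algorithm
  {c ℓ₁ ℓ₂ ℓ} (ℝ : RealNumbers c ℓ₁ ℓ₂) (F : RealCubicField ℝ ℓ) (p q : ℕ)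
  where
  open RealNumbers ℝ
  open RealCubicField F
  open Triangles ℝ

  N : K → ℚ
  N x = det₃ (multiplicationMatrix x)

  K² : Set (c ⊔ ℓ)
  K² = K × K

  ⟦_⟧ : K² → Carrier × Carrier
  ⟦_⟧ = map proj₁ proj₁

  ΔK : Pred K² (ℓ₁ ⊔ ℓ₂)
  ΔK ((α , _) , (β , _)) =
    LinearlyIndependent (1# ∷ α ∷ β ∷ []) × 0# < α × 0# < β × α + β < 1#

  -- The indices 0, 1, 2 stand for γ = 1 - α - β, α, β respectively, so that
  -- v_{i,j} is the expression formed from the components i and j.
  component : K² → Fin 3 → K
  component ((α , α∈K) , (β , β∈K)) 0F =
    (1# - α) - β , +-closed (+-closed 1∈K (-‿closed α∈K)) (-‿closed β∈K)
  component (α , β) 1F = α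
  component (α , β) 2F = β

  IsV : K² → Ind → Carrier → Set (c ⊔ ℓ₁ ⊔ ℓ₂)
  IsV z ((i , j) , _) v =
    ∃[ a ] ∃[ b ]
      proj₁ (component z i) ^[ p / q ]≈ a ×
      proj₁ (component z j) ^[ p / q ]≈ b ×
      v ≈[ a * b / ι ℚ.∣ N (component z i) ℚ.* N (component z j) ∣ ]

  -- ε z ↦ e is the graph of ε: the value at {i , j} is the strict maximum of
  -- the three values v (those at (i , j) and (j , i) coincide), and z lies in
  -- △ (i , j).
  infix 4 ε_↦_ T_↦_

  ε_↦_ : K² → Ind → Set (c ⊔ ℓ₁ ⊔ ℓ₂)
  ε z ↦ e =
    △ e ⟦ z ⟧ ×
    Σ (Ind → Carrier) λ v →
      (∀ d → IsV z d (v d)) × (∀ d → ¬ SamePair d e → v d < v e)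

  T_↦_ : K² → K² → Set (c ⊔ ℓ₁ ⊔ ℓ₂)
  T z ↦ z′ = ∃[ e ] ε z ↦ e × Tᵢⱼ e ⟦ z ⟧ ⟦ z′ ⟧

{-# OPTIONS --safe #-}
-- Writing x₀ = γ, x₁ = α, x₂ = β, the map T_(i,j) replaces xᵢ by (xᵢ - xⱼ) / s
-- and every other coordinate x by x / s, where s = 1 - xⱼ ∈ K.  With
-- f (x) = x ^ r / |N (x)| one has v_{i,j} = f (xᵢ) f (xⱼ), so ε = (i , j) means
-- that f (xₖ) is the smallest of the three values; in particular
-- f (xₖ) < f (xⱼ).  As f is multiplicative, this inequality persists after the
-- step, hence v_{i,k} < v_{i,j} there and {i , k} is not the maximal pair.
-- Inequalities between values of f are expressed through their q-th powers with
-- denominators cleared, which avoids roots and quotients.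
module Submission where

open import Defs
open import Algebra.Bundles using (CommutativeRing)
open import Algebra.Solver.Ring.AlmostCommutativeRing
  using (fromCommutativeRing; _-Raw-AlmostCommutative⟶_)
open import Data.Fin.Base using (Fin)
open import Data.Fin.Patterns using (0F; 1F; 2F)
open import Data.Fin.Properties using (_≟_)
open import Data.Maybe.Base using (Maybe; just; nothing)
open import Data.Nat.Base using (ℕ; zero; suc; NonZero)
open import Data.Nat.Coprimality using (Coprime)
open import Data.Nat.Divisibility using (_∣_)
open import Data.Product.Base using (∃; _×_; _,_; proj₁; proj₂)
open import Data.Rational.Base as ℚ using (ℚ; 0ℚ; 1ℚ)
open import Data.Sum.Base using (inj₁; inj₂)
open import Function.Bundles using (Equivalence)
open import Relation.Binary.PropositionalEquality.Core as ≡ using (_≡_; _≢_)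
open import Relation.Binary.Structures using (IsStrictPartialOrder)
open import Relation.Nullary.Decidable using (Dec; yes; no; _×-dec_; _⊎-dec_)
open import Relation.Nullary.Negation using (¬_; contradiction)
import Algebra.Morphism.Structures as Morphisms
import Algebra.Properties.CommutativeSemiring.Exp as Exp
import Algebra.Properties.Group as GroupProperties
import Algebra.Solver.Ring as RingSolver
import Data.Rational.Properties as ℚ
import Data.Rational.Solver as ℚ
import Relation.Binary.Reasoning.Setoid as SetoidReasoning

-- Rational three-by-three matrices and multiplicativity of the determinant.

Matrix₃ : Set
Matrix₃ = Fin 3 → Fin 3 → ℚ

_⊗_ : Matrix₃ → Matrix₃ → Matrix₃
(a ⊗ b) i j = a i 0F ℚ.* b 0F j ℚ.+ a i 1F ℚ.* b 1F j ℚ.+ a i 2F ℚ.* b 2F j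

-- Comparing coordinates yields only entrywise equality. Rewriting the nine entries that `det₃`
-- reads takes the place of function extensionality.
det₃-cong : ∀ {a b : Matrix₃} → (∀ i j → a i j ≡ b i j) → det₃ a ≡ det₃ b
det₃-cong a≡b
  rewrite a≡b 0F 0F | a≡b 0F 1F | a≡b 0F 2F
        | a≡b 1F 0F | a≡b 1F 1F | a≡b 1F 2F
        | a≡b 2F 0F | a≡b 2F 1F | a≡b 2F 2F = ≡.refl

det₃-⊗ : ∀ a b → det₃ (a ⊗ b) ≡ det₃ a ℚ.* det₃ b
det₃-⊗ a b =
  solve 18
    (λ a₀₀ a₀₁ a₀₂ a₁₀ a₁₁ a₁₂ a₂₀ a₂₁ a₂₂ b₀₀ b₀₁ b₀₂ b₁₀ b₁₁ b₁₂ b₂₀ b₂₁ b₂₂ →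
      let _·_ : Row → Row → Polynomial 18
          _·_ = λ (x , y , z) (x′ , y′ , z′) → x :* x′ :+ y :* y′ :+ z :* z′
          a₀ = a₀₀ , a₀₁ , a₀₂
          a₁ = a₁₀ , a₁₁ , a₁₂
          a₂ = a₂₀ , a₂₁ , a₂₂
          -- The triples `b₀`, `b₁`, `b₂` are the columns of `b`, so that each entry of the product
          -- is a dot product; the right-hand side lists the rows instead.
          b₀ = b₀₀ , b₁₀ , b₂₀
          b₁ = b₀₁ , b₁₁ , b₂₁
          b₂ = b₀₂ , b₁₂ , b₂₂
      in
      det (a₀ · b₀ , a₀ · b₁ , a₀ · b₂)
          (a₁ · b₀ , a₁ · b₁ , a₁ · b₂)
          (a₂ · b₀ , a₂ · b₁ , a₂ · b₂)
      := det a₀ a₁ a₂ :* det (b₀₀ , b₀₁ , b₀₂) (b₁₀ , b₁₁ , b₁₂) (b₂₀ , b₂₁ , b₂₂))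
    ≡.refl
    (a 0F 0F) (a 0F 1F) (a 0F 2F)
    (a 1F 0F) (a 1F 1F) (a 1F 2F)
    (a 2F 0F) (a 2F 1F) (a 2F 2F)
    (b 0F 0F) (b 0F 1F) (b 0F 2F)
    (b 1F 0F) (b 1F 1F) (b 1F 2F)
    (b 2F 0F) (b 2F 1F) (b 2F 2F)
  where
  open ℚ.+-*-Solver
  Row : Set
  Row = Polynomial 18 × Polynomial 18 × Polynomial 18
  det : Row → Row → Row → Polynomial 18
  det (x , y , z) (x′ , y′ , z′) (x″ , y″ , z″) =
    x :* (y′ :* z″ :- z′ :* y″)
      :- y :* (x′ :* z″ :- z′ :* x″)
      :+ z :* (x′ :* y″ :- y′ :* x″)

-- Unordered pairs of indices.

SamePair? : ∀ d e → Dec (SamePair d e)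
SamePair? ((i , j) , _) ((k , l) , _) =
  (i ≟ k ×-dec j ≟ l) ⊎-dec (i ≟ l ×-dec j ≟ k)

SamePair-sym : ∀ {d e} → SamePair d e → SamePair e d
SamePair-sym (inj₁ (i≡k , j≡l)) = inj₁ (≡.sym i≡k , ≡.sym j≡l)
SamePair-sym (inj₂ (i≡l , j≡k)) = inj₂ (≡.sym j≡k , ≡.sym i≡l)

SamePair-trans : ∀ {d e f} → SamePair d e → SamePair e f → SamePair d f
SamePair-trans (inj₁ (≡.refl , ≡.refl)) e∼f = e∼f
SamePair-trans (inj₂ (≡.refl , ≡.refl)) (inj₁ (≡.refl , ≡.refl)) = inj₂ (≡.refl , ≡.refl)
SamePair-trans (inj₂ (≡.refl , ≡.refl)) (inj₂ (≡.refl , ≡.refl)) = inj₁ (≡.refl , ≡.refl)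

-- An arbitrary partner completes `i` to an element of `Ind`, so that facts about a single
-- coordinate can be read off from some v_{i,l}.
other : (i : Fin 3) → ∃ (i ≢_)
other 0F = 1F , λ ()
other 1F = 0F , λ ()
other 2F = 0F , λ ()

p*q≢0⇒p≢0 : ∀ p q → p ℚ.* q ≢ 0ℚ → p ≢ 0ℚ
p*q≢0⇒p≢0 _ q pq≢0 ≡.refl = pq≢0 (ℚ.*-zeroˡ q)

p*q≢0⇒q≢0 : ∀ p q → p ℚ.* q ≢ 0ℚ → q ≢ 0ℚ
p*q≢0⇒q≢0 p _ pq≢0 ≡.refl = pq≢0 (ℚ.*-zeroʳ p)

-- Ordered field arithmetic of the reals.

module OrderedFieldProperties {c ℓ₁ ℓ₂} (ℝ : RealNumbers c ℓ₁ ℓ₂) where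
  open RealNumbers ℝ
  open CommutativeRing commutativeRing public
    using (commutativeSemiring)
  open IsStrictPartialOrder isStrictPartialOrder public
    using (<-respˡ-≈; <-respʳ-≈)
    renaming (trans to <-trans; asym to <-asym; irrefl to <-irrefl)
  open Exp commutativeSemiring public using (^-congˡ; ^-distrib-*)
  open Morphisms.RingMorphisms.IsRingHomomorphism ι-isRingHomomorphism public
    using ()
    renaming ( +-homo to ι-+-homo; *-homo to ι-*-homo; -‿homo to ι-‿homo
             ; 0#-homo to ι-0-homo; 1#-homo to ι-1-homo)
  open SetoidReasoning setoid

  ι-cong : ∀ {a b} → a ≡ b → ι a ≈ ι b
  ι-cong ≡.refl = refl

  private
    ι-morphism :
      ℚ.+-*-rawRing -Raw-AlmostCommutative⟶ fromCommutativeRing commutativeRing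
    ι-morphism = record
      { ⟦_⟧    = ι
      ; +-homo = ι-+-homo
      ; *-homo = ι-*-homo
      ; -‿homo = ι-‿homo
      ; 0-homo = ι-0-homo
      ; 1-homo = ι-1-homo
      }

    _ι≟_ : ∀ a b → Maybe (ι a ≈ ι b)
    a ι≟ b with a ℚ.≟ b
    ... | yes a≡b = just (ι-cong a≡b)
    ... | no  _   = nothing

  -- Normalising polynomials requires a test for equal coefficients. Coefficients are therefore
  -- rational, where equality is decidable, and `ι` interprets them among the reals.
  module Solver = RingSolver ℚ.+-*-rawRing
    (fromCommutativeRing commutativeRing) ι-morphism _ι≟_
  open Solver

  <-resp : ∀ {x x′ y y′} → x ≈ x′ → y ≈ y′ → x < y → x′ < y′
  <-resp x≈x′ y≈y′ x<y = <-respʳ-≈ y≈y′ (<-respˡ-≈ x≈x′ x<y)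

  x<y⇒0<y-x : ∀ {x y} → x < y → 0# < y - x
  x<y⇒0<y-x {x} x<y = <-respˡ-≈ (-‿inverseʳ x) (+-monoˡ-< (- x) x<y)

  x<y⇒x-y<0 : ∀ {x y} → x < y → x - y < 0#
  x<y⇒x-y<0 {y = y} x<y = <-respʳ-≈ (-‿inverseʳ y) (+-monoˡ-< (- y) x<y)

  0<y-x⇒x<y : ∀ {x y} → 0# < y - x → x < y
  0<y-x⇒x<y {x} {y} 0<y-x =
    <-resp (+-identityˡ x) (solve 2 (λ x y → y :- x :+ x := y) refl x y)
      (+-monoˡ-< x 0<y-x)

  *-monoˡ-< : ∀ {x y z} → 0# < z → x < y → x * z < y * z
  *-monoˡ-< {x} {y} {z} 0<z x<y = 0<y-x⇒x<y
    (<-respʳ-≈ (solve 3 (λ x y z → (y :- x) :* z := y :* z :- x :* z) refl x y z)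
      (*-pos (x<y⇒0<y-x x<y) 0<z))

  *-mono-< : ∀ {w x y z} → 0# < w → 0# < y → w < x → y < z → w * y < x * z
  *-mono-< {w} {x} {y} {z} 0<w 0<y w<x y<z =
    <-trans (*-monoˡ-< 0<y w<x)
      (<-resp (*-comm y x) (*-comm z x) (*-monoˡ-< (<-trans 0<w w<x) y<z))

  0<1 : 0# < 1#
  0<1 = <-resp ι-0-homo ι-1-homo (ι-mono-< (ℚ.positive⁻¹ 1ℚ))

  ^-pos : ∀ {x} n → 0# < x → 0# < x ^ n
  ^-pos zero    0<x = 0<1
  ^-pos (suc n) 0<x = *-pos 0<x (^-pos n 0<x)

  ^-monoˡ-< : ∀ n → .{{NonZero n}} → ∀ {x y} → 0# < x → x < y → x ^ n < y ^ n
  ^-monoˡ-< (suc zero)          0<x x<y =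
    <-resp (sym (*-identityʳ _)) (sym (*-identityʳ _)) x<y
  ^-monoˡ-< (suc n@(suc _)) {x} 0<x x<y =
    *-mono-< 0<x (^-pos n 0<x) x<y (^-monoˡ-< n 0<x x<y)

  -- Without a decidable order, the apartness `y # 0#` supplies the case distinction on the sign of
  -- `y`; a negative `y` would make the product negative.
  y#0∧0<x∧0<x*y⇒0<y : ∀ {x y} → y # 0# → 0# < x → 0# < x * y → 0# < y
  y#0∧0<x∧0<x*y⇒0<y {x} {y} y#0 0<x 0<xy with Equivalence.to #⇔<⊎> y#0
  ... | inj₂ 0<y = 0<y
  ... | inj₁ y<0 = contradiction
    (<-resp (*-comm y x) (zeroˡ x) (*-monoˡ-< 0<x y<0)) (<-asym 0<xy)

  ι∣∣-pos : ∀ {a} → a ≢ 0ℚ → 0# < ι ℚ.∣ a ∣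
  ι∣∣-pos {a} a≢0 = <-respˡ-≈ ι-0-homo (ι-mono-<
    (ℚ.≰⇒> λ ∣a∣≤0 → a≢0 (ℚ.∣p∣≡0⇒p≡0 a (ℚ.≤-antisym ∣a∣≤0 (ℚ.0≤∣p∣ a)))))

  -- Turns the condition that the denominator of v is apart from zero into nonvanishing of a
  -- rational norm.
  ι∣∣#0⇒≢0 : ∀ {a} → ι ℚ.∣ a ∣ # 0# → a ≢ 0ℚ
  ι∣∣#0⇒≢0 ι∣a∣#0 ≡.refl with Equivalence.to #⇔<⊎> ι∣a∣#0
  ... | inj₁ ι0<0 = <-irrefl ι-0-homo ι0<0
  ... | inj₂ 0<ι0 = <-irrefl (sym ι-0-homo) 0<ι0

  ι∣∣-*-homo : ∀ a b → ι ℚ.∣ a ℚ.* b ∣ ≈ ι ℚ.∣ a ∣ * ι ℚ.∣ b ∣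
  ι∣∣-*-homo a b = trans (ι-cong (ℚ.∣p*q∣≡∣p∣*∣q∣ a b)) (ι-*-homo _ _)

-- Multiplicativity of the norm.

module NormProperties {c ℓ₁ ℓ₂ ℓ} (ℝ : RealNumbers c ℓ₁ ℓ₂)
                      (F : RealCubicField ℝ ℓ) where
  open RealNumbers ℝ
  open RealCubicField F
  open OrderedFieldProperties ℝ
  open Solver
  open SetoidReasoning setoid

  combination₃ : ∀ a v → combination {3} a v ≈
    ι (a 0F) * v 0F + ι (a 1F) * v 1F + ι (a 2F) * v 2F
  combination₃ a v = trans (+-congˡ (+-congˡ (+-identityʳ _))) (sym (+-assoc _ _ _))

  ι-homo-minus : ∀ a b → ι (a ℚ.- b) ≈ ι a - ι b
  ι-homo-minus a b = trans (ι-+-homo a (ℚ.- b)) (+-congˡ (ι-‿homo b))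

  combination-injective : ∀ a b → combination a basis ≈ combination b basis →
                          ∀ i → a i ≡ b i
  combination-injective a b eq i =
    ℚ-Group.x∙y⁻¹≈ε⇒x≈y (a i) (b i) (basisIndependent (λ i → a i ℚ.- b i) difference≈0 i)
    where
    module ℚ-Group = GroupProperties ℚ.+-0-group
    difference≈0 : combination (λ i → a i ℚ.- b i) basis ≈ 0#
    difference≈0 = begin
      combination (λ i → a i ℚ.- b i) basis
        ≈⟨ combination₃ (λ i → a i ℚ.- b i) basis ⟩
      ι (a 0F ℚ.- b 0F) * basis 0F + ι (a 1F ℚ.- b 1F) * basis 1F + ι (a 2F ℚ.- b 2F) * basis 2F
        ≈⟨ +-cong (+-cong (*-congʳ (ι-homo-minus _ _)) (*-congʳ (ι-homo-minus _ _)))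
                  (*-congʳ (ι-homo-minus _ _)) ⟩
      (ι (a 0F) - ι (b 0F)) * basis 0F + (ι (a 1F) - ι (b 1F)) * basis 1F + (ι (a 2F) - ι (b 2F)) * basis 2F
        ≈⟨ solve 9 (λ a₀ a₁ a₂ b₀ b₁ b₂ v₀ v₁ v₂ →
             (a₀ :- b₀) :* v₀ :+ (a₁ :- b₁) :* v₁ :+ (a₂ :- b₂) :* v₂
             := (a₀ :* v₀ :+ a₁ :* v₁ :+ a₂ :* v₂) :- (b₀ :* v₀ :+ b₁ :* v₁ :+ b₂ :* v₂))
             refl _ _ _ _ _ _ _ _ _ ⟩
      (ι (a 0F) * basis 0F + ι (a 1F) * basis 1F + ι (a 2F) * basis 2F)
        - (ι (b 0F) * basis 0F + ι (b 1F) * basis 1F + ι (b 2F) * basis 2F)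
        ≈⟨ +-cong (combination₃ a basis) (-‿cong (combination₃ b basis)) ⟨
      combination a basis - combination b basis
        ≈⟨ +-congʳ eq ⟩
      combination b basis - combination b basis
        ≈⟨ -‿inverseʳ _ ⟩
      0# ∎

  -- Expanding `y * basis j` in the basis, then each `x * basis k`, writes `z * basis j` with column
  -- `j` of the matrix product as coefficients; coordinates are unique. Since `coordinates` depends
  -- on a membership proof, the product enters as any `z` with the right value.
  multiplicationMatrix-* : ∀ x y z → proj₁ x * proj₁ y ≈ proj₁ z → ∀ i j →
    multiplicationMatrix z i j ≡ (multiplicationMatrix x ⊗ multiplicationMatrix y) i j
  multiplicationMatrix-* x y z xy≈z i j = combination-injective
    (λ i → multiplicationMatrix z i j)
    (λ i → (multiplicationMatrix x ⊗ multiplicationMatrix y) i j)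
    column i
    where
    X = multiplicationMatrix x
    Y = multiplicationMatrix y
    column-of : ∀ w k → proj₁ w * basis k ≈
      ι (multiplicationMatrix w 0F k) * basis 0F
        + ι (multiplicationMatrix w 1F k) * basis 1F
        + ι (multiplicationMatrix w 2F k) * basis 2F
    column-of w k = trans (basisSpans (*-closed (proj₂ w) (basis∈K k))) 
      (combination₃ (λ i → multiplicationMatrix w i k) basis)
    ι-⊗ : ∀ i → ι ((X ⊗ Y) i j) ≈
      ι (X i 0F) * ι (Y 0F j) + ι (X i 1F) * ι (Y 1F j) + ι (X i 2F) * ι (Y 2F j)
    ι-⊗ i = trans (ι-+-homo _ _)
      (+-cong (trans (ι-+-homo _ _) (+-cong (ι-*-homo _ _) (ι-*-homo _ _))) (ι-*-homo _ _))
    column : combination (λ i → multiplicationMatrix z i j) basis ≈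
             combination (λ i → (X ⊗ Y) i j) basis
    column = begin
      combination (λ i → multiplicationMatrix z i j) basis
        ≈⟨ basisSpans (*-closed (proj₂ z) (basis∈K j)) ⟨
      proj₁ z * basis j
        ≈⟨ *-congʳ xy≈z ⟨
      proj₁ x * proj₁ y * basis j
        ≈⟨ *-assoc _ _ _ ⟩
      proj₁ x * (proj₁ y * basis j)
        ≈⟨ *-congˡ (column-of y j) ⟩
      proj₁ x * (ι (Y 0F j) * basis 0F + ι (Y 1F j) * basis 1F + ι (Y 2F j) * basis 2F)
        ≈⟨ solve 7 (λ x y₀ y₁ y₂ v₀ v₁ v₂ →
             x :* (y₀ :* v₀ :+ y₁ :* v₁ :+ y₂ :* v₂)
             := y₀ :* (x :* v₀) :+ y₁ :* (x :* v₁) :+ y₂ :* (x :* v₂))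
             refl _ _ _ _ _ _ _ ⟩
      ι (Y 0F j) * (proj₁ x * basis 0F) + ι (Y 1F j) * (proj₁ x * basis 1F)
        + ι (Y 2F j) * (proj₁ x * basis 2F)
        ≈⟨ +-cong (+-cong (*-congˡ (column-of x 0F)) (*-congˡ (column-of x 1F)))
                  (*-congˡ (column-of x 2F)) ⟩
      _
        ≈⟨ solve 15 (λ y₀ y₁ y₂ v₀ v₁ v₂ x₀₀ x₁₀ x₂₀ x₀₁ x₁₁ x₂₁ x₀₂ x₁₂ x₂₂ →
             y₀ :* (x₀₀ :* v₀ :+ x₁₀ :* v₁ :+ x₂₀ :* v₂)
               :+ y₁ :* (x₀₁ :* v₀ :+ x₁₁ :* v₁ :+ x₂₁ :* v₂)
               :+ y₂ :* (x₀₂ :* v₀ :+ x₁₂ :* v₁ :+ x₂₂ :* v₂)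
             := (x₀₀ :* y₀ :+ x₀₁ :* y₁ :+ x₀₂ :* y₂) :* v₀
               :+ (x₁₀ :* y₀ :+ x₁₁ :* y₁ :+ x₁₂ :* y₂) :* v₁
               :+ (x₂₀ :* y₀ :+ x₂₁ :* y₁ :+ x₂₂ :* y₂) :* v₂)
             refl _ _ _ _ _ _ _ _ _ _ _ _ _ _ _ ⟩
      _
        ≈⟨ +-cong (+-cong (*-congʳ (ι-⊗ 0F)) (*-congʳ (ι-⊗ 1F))) (*-congʳ (ι-⊗ 2F)) ⟨
      ι ((X ⊗ Y) 0F j) * basis 0F + ι ((X ⊗ Y) 1F j) * basis 1F + ι ((X ⊗ Y) 2F j) * basis 2F
        ≈⟨ combination₃ (λ i → (X ⊗ Y) i j) basis ⟨
      combination (λ i → (X ⊗ Y) i j) basis ∎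

  -- Definitionally the `N` of `Algorithm`, but independent of the exponents `p` and `q`.
  norm : K → ℚ
  norm x = det₃ (multiplicationMatrix x)

  norm-* : ∀ x y z → proj₁ x * proj₁ y ≈ proj₁ z → norm z ≡ norm x ℚ.* norm y
  norm-* x y z xy≈z = ≡.trans
    (det₃-cong (multiplicationMatrix-* x y z xy≈z))
    (det₃-⊗ (multiplicationMatrix x) (multiplicationMatrix y))

module AlgorithmProperties {c ℓ₁ ℓ₂ ℓ} (ℝ : RealNumbers c ℓ₁ ℓ₂) (F : RealCubicField ℝ ℓ)
                           (p q : ℕ) .{{_ : NonZero q}} where
  open RealNumbers ℝ
  open RealCubicField F
  open Triangles ℝ
  open Algorithm ℝ F p q
  open OrderedFieldProperties ℝ
  open NormProperties ℝ F
  open Solver hiding (⟦_⟧)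
  open SetoidReasoning setoid

  -- The maps T_(i,j) as rescalings of the three coordinates.

  coord : K² → Fin 3 → Carrier
  coord z i = proj₁ (component z i)

  private
    2#*-double : ∀ x → 2# * x ≈ x + x
    2#*-double x = trans (distribʳ x 1# 1#) (+-cong (*-identityˡ x) (*-identityˡ x))

    -- The formulas of T_(i,j) give only the coordinates with indices 1 and 2; this recovers the one
    -- with index 0.
    γ-scale : ∀ {s x y a b} → x * s ≈ a → y * s ≈ b →
              ((1# - x) - y) * s ≈ (s - a) - b
    γ-scale {s} {x} {y} {a} {b} xs≈a ys≈b = begin
      ((1# - x) - y) * s
        -- Solver constants denote values of `ι`, so `1#` is passed as a variable `o`, and `1# * s`
        -- has to be simplified separately.
        ≈⟨ solve 4 (λ o x y s → ((o :- x) :- y) :* s := (o :* s :- x :* s) :- y :* s)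
             refl 1# x y s ⟩
      (1# * s - x * s) - y * s
        ≈⟨ +-cong (+-cong (*-identityˡ s) (-‿cong xs≈a)) (-‿cong ys≈b) ⟩
      (s - a) - b ∎

    α-γ : ∀ x y → (2# * x + y) - 1# ≈ x - ((1# - x) - y)
    α-γ x y = trans (+-congʳ (+-congʳ (2#*-double x)))
      (solve 3 (λ o x y → ((x :+ x) :+ y) :- o := x :- ((o :- x) :- y)) refl 1# x y)

    β-γ : ∀ x y → (x + 2# * y) - 1# ≈ y - ((1# - x) - y)
    β-γ x y = trans (+-congʳ (+-congˡ (2#*-double y)))
      (solve 3 (λ o x y → (x :+ (y :+ y)) :- o := y :- ((o :- x) :- y)) refl 1# x y)

  -- By `α-γ` and `β-γ`, the linear forms bounding the triangles with an index 0 are differences of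
  -- two coordinates, which makes all six conditions uniform.
  half⇒≤ : ∀ {i j} (i≢j : i ≢ j) z → half ((i , j) , i≢j) ⟦ z ⟧ → coord z j ≤ coord z i
  half⇒≤ {0F} {0F} i≢j _ _ = contradiction ≡.refl i≢j
  half⇒≤ {1F} {1F} i≢j _ _ = contradiction ≡.refl i≢j
  half⇒≤ {2F} {2F} i≢j _ _ = contradiction ≡.refl i≢j
  half⇒≤ {1F} {2F} _ _ β≤α = β≤α
  half⇒≤ {2F} {1F} _ _ α≤β = α≤β
  half⇒≤ {0F} {1F} _ ((x , _) , (y , _)) h γ<α =
    h (<-respʳ-≈ (sym (α-γ x y)) (x<y⇒0<y-x γ<α))
  half⇒≤ {1F} {0F} _ ((x , _) , (y , _)) h α<γ =
    h (<-respˡ-≈ (sym (α-γ x y)) (x<y⇒x-y<0 α<γ))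
  half⇒≤ {0F} {2F} _ ((x , _) , (y , _)) h γ<β =
    h (<-respʳ-≈ (sym (β-γ x y)) (x<y⇒0<y-x γ<β))
  half⇒≤ {2F} {0F} _ ((x , _) , (y , _)) h β<γ =
    h (<-respˡ-≈ (sym (β-γ x y)) (x<y⇒x-y<0 β<γ))

  -- The quotients are stated as products with `s`, and `s` is taken in `K` so that it has a norm.
  Scaling : Fin 3 → Fin 3 → K² → K² → K → Set _
  Scaling i j z z′ (s , _) =
    s # 0# × coord z′ i * s ≈ coord z i - coord z j ×
    (∀ k → k ≢ i → coord z′ k * s ≈ coord z k)

  Tᵢⱼ⇒Scaling : ∀ {i j} (i≢j : i ≢ j) z z′ → Tᵢⱼ ((i , j) , i≢j) ⟦ z ⟧ ⟦ z′ ⟧ →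
                ∃ (Scaling i j z z′)
  Tᵢⱼ⇒Scaling {0F} {0F} i≢j _ _ _ = contradiction ≡.refl i≢j
  Tᵢⱼ⇒Scaling {1F} {1F} i≢j _ _ _ = contradiction ≡.refl i≢j
  Tᵢⱼ⇒Scaling {2F} {2F} i≢j _ _ _ = contradiction ≡.refl i≢j
  Tᵢⱼ⇒Scaling {1F} {2F} _ ((x , _) , (y , y∈K)) _ (_ , (s#0 , α′) , (_ , β′)) =
    (1# - y , +-closed 1∈K (-‿closed y∈K)) , s#0 , α′ , λ where
      0F _ → trans (γ-scale α′ β′)
        (solve 3 (λ o x y → ((o :- y) :- (x :- y)) :- y := (o :- x) :- y) refl 1# x y)
      1F k≢i → contradiction ≡.refl k≢i
      2F _ → β′
  Tᵢⱼ⇒Scaling {2F} {1F} _ ((x , x∈K) , (y , _)) _ (_ , (s#0 , α′) , (_ , β′)) =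
    (1# - x , +-closed 1∈K (-‿closed x∈K)) , s#0 , β′ , λ where
      0F _ → trans (γ-scale α′ β′)
        (solve 3 (λ o x y → ((o :- x) :- x) :- (y :- x) := (o :- x) :- y) refl 1# x y)
      1F _ → α′
      2F k≢i → contradiction ≡.refl k≢i
  Tᵢⱼ⇒Scaling {0F} {1F} _ ((x , x∈K) , (y , _)) _ (_ , (s#0 , α′) , (_ , β′)) =
    (1# - x , +-closed 1∈K (-‿closed x∈K)) , s#0 ,
    trans (γ-scale α′ β′)
      (solve 3 (λ o x y → ((o :- x) :- x) :- y := ((o :- x) :- y) :- x) refl 1# x y) ,
    λ where
      0F k≢i → contradiction ≡.refl k≢i
      1F _ → α′
      2F _ → β′
  Tᵢⱼ⇒Scaling {0F} {2F} _ ((x , _) , (y , y∈K)) _ (_ , (s#0 , α′) , (_ , β′)) =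
    (1# - y , +-closed 1∈K (-‿closed y∈K)) , s#0 ,
    trans (γ-scale α′ β′)
      (solve 3 (λ o x y → ((o :- y) :- x) :- y := ((o :- x) :- y) :- y) refl 1# x y) ,
    λ where
      0F k≢i → contradiction ≡.refl k≢i
      1F _ → α′
      2F _ → β′
  Tᵢⱼ⇒Scaling {1F} {0F} _ ((x , x∈K) , (y , y∈K)) _ (_ , (s#0 , α′) , (_ , β′)) =
    -- For `j = 0` the scale 1 - xⱼ = 1 - γ is `x + y`.
    (x + y , +-closed x∈K y∈K) , s#0 , α″ , λ where
      0F _ → trans (γ-scale α″ β′)
        (solve 3 (λ o x y → ((x :+ y) :- (x :- ((o :- x) :- y))) :- y := (o :- x) :- y)
          refl 1# x y)
      1F k≢i → contradiction ≡.refl k≢i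
      2F _ → β′
    where α″ = trans α′ (α-γ x y)
  Tᵢⱼ⇒Scaling {2F} {0F} _ ((x , x∈K) , (y , y∈K)) _ (_ , (s#0 , α′) , (_ , β′)) =
    (x + y , +-closed x∈K y∈K) , s#0 , β″ , λ where
      0F _ → trans (γ-scale α′ β″)
        (solve 3 (λ o x y → ((x :+ y) :- x) :- (y :- ((o :- x) :- y)) := (o :- x) :- y)
          refl 1# x y)
      1F _ → α′
      2F k≢i → contradiction ≡.refl k≢i
    where β″ = trans β′ (β-γ x y)

  -- v_{i,j} ^ q = power z d / normPower z d for d = (i , j).
  coordPower coordNorm : K² → Fin 3 → Carrier
  coordPower z i = coord z i ^ p
  coordNorm  z i = ι ℚ.∣ N (component z i) ∣ ^ q

  power normPower : K² → Ind → Carrier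
  power     z ((i , j) , _) = coordPower z i * coordPower z j
  normPower z ((i , j) , _) = coordNorm z i * coordNorm z j

  power-cong : ∀ z {d e} → SamePair d e → power z d ≈ power z e
  power-cong z (inj₁ (≡.refl , ≡.refl)) = refl
  power-cong z (inj₂ (≡.refl , ≡.refl)) = *-comm _ _

  normPower-cong : ∀ z {d e} → SamePair d e → normPower z d ≈ normPower z e
  normPower-cong z (inj₁ (≡.refl , ≡.refl)) = refl
  normPower-cong z (inj₂ (≡.refl , ≡.refl)) = *-comm _ _

  -- Comparison of the values v with roots and denominators cleared.

  pairNorm : K² → Ind → Carrier
  pairNorm z ((i , j) , _) = ι ℚ.∣ N (component z i) ℚ.* N (component z j) ∣

  pairNorm-^ : ∀ z d → pairNorm z d ^ q ≈ normPower z d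
  pairNorm-^ z ((i , j) , _) =
    trans (^-congˡ q (ι∣∣-*-homo (N (component z i)) (N (component z j)))) (^-distrib-* _ _ q)

  -- Multiplying `v < v′` by both denominators gives `a * b * D′ < a′ * b′ * D` between positive
  -- numbers; raising to the power `q` then replaces the roots by `p`-th powers.
  IsV⇒< : ∀ z d e {v v′} → IsV z d v → IsV z e v′ → v < v′ →
          power z d * normPower z e < power z e * normPower z d
  IsV⇒< z d e {v} {v′} (a , b , (_ , 0<a , a^q) , (_ , 0<b , b^q) , D#0 , vD≈ab)
    (a′ , b′ , (_ , _ , a′^q) , (_ , _ , b′^q) , D′#0 , v′D′≈a′b′) v<v′ =
    <-resp (raise a b a^q b^q e) (raise a′ b′ a′^q b′^q d)
      (^-monoˡ-< q (*-pos (*-pos 0<a 0<b) 0<D′) abD′<a′b′D)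
    where
    D = pairNorm z d
    D′ = pairNorm z e
    0<D : 0# < D
    0<D = ι∣∣-pos (ι∣∣#0⇒≢0 D#0)
    0<D′ : 0# < D′
    0<D′ = ι∣∣-pos (ι∣∣#0⇒≢0 D′#0)
    abD′<a′b′D : a * b * D′ < a′ * b′ * D
    abD′<a′b′D = <-resp
      (trans (sym (*-assoc v D D′)) (*-congʳ vD≈ab))
      (trans (solve 3 (λ v d d′ → v :* (d :* d′) := v :* d′ :* d) refl v′ D D′)
        (*-congʳ v′D′≈a′b′))
      (*-monoˡ-< (*-pos 0<D 0<D′) v<v′)
    raise : ∀ a b {x y} → a ^ q ≈ x → b ^ q ≈ y → ∀ f →
            (a * b * pairNorm z f) ^ q ≈ x * y * normPower z f
    raise a b a^q b^q f = trans (^-distrib-* _ _ q)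
      (*-cong (trans (^-distrib-* _ _ q) (*-cong a^q b^q)) (pairNorm-^ z f))

  ε-max : ∀ {z d e e′} → ε z ↦ e → SamePair e e′ → ¬ SamePair d e →
          power z d * normPower z e′ < power z e′ * normPower z d
  ε-max {z} {d} {e} {e′} (_ , _ , isV , max) e∼e′ d≁e =
    <-resp (*-congˡ (normPower-cong z {e} {e′} e∼e′)) (*-congʳ (power-cong z {e} {e′} e∼e′))
      (IsV⇒< z d e (isV d) (isV e) (max d d≁e))

  -- Two different maximal pairs would each strictly exceed the other. Only the unordered pair is
  -- settled here, since the closed triangles of (i , j) and (j , i) share a boundary.
  ε-unique : ∀ {z d e} → ε z ↦ d → ε z ↦ e → SamePair d e
  ε-unique {z} {d} {e} εd εe with SamePair? d e
  ... | yes d∼e = d∼e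
  ... | no  d≁e = contradiction
    (ε-max {d = e} {d} {d} εd (inj₁ (≡.refl , ≡.refl)) (λ e∼d → d≁e (SamePair-sym {e} {d} e∼d)))
    (<-asym (ε-max {d = d} {e} {e} εe (inj₁ (≡.refl , ≡.refl)) d≁e))

  -- A fractional power demands a positive base, and `ε` provides a value v for every pair of
  -- indices.
  coord-pos : ∀ {z e} → ε z ↦ e → ∀ i → 0# < coord z i
  coord-pos (_ , _ , isV , _) i with isV ((i , _) , proj₂ (other i))
  ... | _ , _ , (0<x , _) , _ = 0<x

  N≢0 : ∀ {z e} → ε z ↦ e → ∀ i → N (component z i) ≢ 0ℚ
  N≢0 {z} (_ , _ , isV , _) i with isV ((i , _) , proj₂ (other i))
  ... | _ , _ , _ , _ , D#0 , _ =
    p*q≢0⇒p≢0 _ (N (component z (proj₁ (other i)))) (ι∣∣#0⇒≢0 D#0)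

  -- The effect of one step on the maximal pair.

  Scaling⇒0<s : ∀ {i j z z′ e e′} → i ≢ j → ε z ↦ e → ε z′ ↦ e′ →
                ∀ s → Scaling i j z z′ s → 0# < proj₁ s
  Scaling⇒0<s {j = j} i≢j εz εz′ _ (s#0 , _ , scale) =
    -- Coordinate `j` is only rescaled, and it is positive both before and after the step.
    y#0∧0<x∧0<x*y⇒0<y s#0 (coord-pos εz′ j)
      (<-respʳ-≈ (sym (scale j (λ j≡i → i≢j (≡.sym j≡i)))) (coord-pos εz j))

  -- The difference of the two coordinates is `s` times the new coordinate `i`, and both factors are
  -- positive.
  Scaling⇒coord< : ∀ {i j z z′ e e′} → i ≢ j → ε z ↦ e → ε z′ ↦ e′ →
                   ∀ s → Scaling i j z z′ s → coord z j < coord z i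
  Scaling⇒coord< {i} i≢j εz εz′ s σ@(_ , difference , _) = 0<y-x⇒x<y
    (<-respʳ-≈ difference (*-pos (coord-pos εz′ i) (Scaling⇒0<s i≢j εz εz′ s σ)))

  Scaling⇒avoids : ∀ {i j k z z′ e} (i≢j : i ≢ j) (i≢k : i ≢ k) → k ≢ j →
    ε z ↦ ((i , j) , i≢j) → ε z′ ↦ e → ∃ (Scaling i j z z′) →
    ¬ SamePair e ((i , k) , i≢k)
  Scaling⇒avoids {i} {j} {k} {z} {z′} {e} i≢j i≢k k≢j εz εz′ (s , σ@(_ , _ , scale)) e∼ik =
    -- Coordinate `i` is not merely rescaled, so its factors in `before` and `after` differ; each
    -- inequality is multiplied by the factors of `i` from the other point. With `s^p * Ns^q` also
    -- multiplied into `after`, the two compare the same numbers in opposite directions.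
    <-irrefl refl (<-trans
      (<-resp
        (*-congʳ (*-cong (*-congˡ (coordPower-scale k≢i)) (*-congˡ (coordNorm-scale j≢i))))
        (*-congʳ (*-cong (*-congˡ (coordPower-scale j≢i)) (*-congˡ (coordNorm-scale k≢i))))
        (*-monoˡ-< 0<W′ before))
      (<-resp
        (rearrange _ _ _ _ _ _ _ _)
        (rearrange _ _ _ _ _ _ _ _)
        (*-monoˡ-< 0<W after)))
    where
    ij ik : Ind
    ij = (i , j) , i≢j
    ik = (i , k) , i≢k
    j≢i : j ≢ i
    j≢i j≡i = i≢j (≡.sym j≡i)
    k≢i : k ≢ i
    k≢i k≡i = i≢k (≡.sym k≡i)
    ik≁ij : ¬ SamePair ik ij
    ik≁ij (inj₁ (_ , k≡j)) = k≢j k≡j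
    ik≁ij (inj₂ (_ , k≡i)) = k≢i k≡i
    ij≁e : ¬ SamePair ij e
    ij≁e ij∼e = ik≁ij (SamePair-sym {ij} {ik} (SamePair-trans {ij} {e} {ik} ij∼e e∼ik))
    before : power z ik * normPower z ij < power z ij * normPower z ik
    before = ε-max {d = ik} {ij} {ij} εz (inj₁ (≡.refl , ≡.refl)) ik≁ij
    after : power z′ ij * normPower z′ ik < power z′ ik * normPower z′ ij
    after = ε-max {d = ij} {e} {ik} εz′ e∼ik ij≁e
    s^p = proj₁ s ^ p
    Ns^q = ι ℚ.∣ N s ∣ ^ q
    Ns-scale : ∀ {l} → l ≢ i → N (component z l) ≡ N (component z′ l) ℚ.* N s
    Ns-scale {l} l≢i = norm-* (component z′ l) s (component z l) (scale l l≢i)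
    coordPower-scale : ∀ {l} → l ≢ i → coordPower z l ≈ coordPower z′ l * s^p
    coordPower-scale {l} l≢i = trans (^-congˡ p (sym (scale l l≢i))) (^-distrib-* _ _ p)
    coordNorm-scale : ∀ {l} → l ≢ i → coordNorm z l ≈ coordNorm z′ l * Ns^q
    coordNorm-scale {l} l≢i = trans
      (^-congˡ q (trans (ι-cong (≡.cong ℚ.∣_∣ (Ns-scale l≢i))) (ι∣∣-*-homo _ _)))
      (^-distrib-* _ _ q)
    Ns≢0 : N s ≢ 0ℚ
    Ns≢0 = p*q≢0⇒q≢0 (N (component z′ j)) (N s)
      (≡.subst (_≢ 0ℚ) (Ns-scale j≢i) (N≢0 εz j))
    coordWeight-pos : ∀ {z e} → ε z ↦ e → 0# < coordPower z i * coordNorm z i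
    coordWeight-pos εz = *-pos (^-pos p (coord-pos εz i)) (^-pos q (ι∣∣-pos (N≢0 εz i)))
    0<W′ : 0# < coordPower z′ i * coordNorm z′ i
    0<W′ = coordWeight-pos εz′
    0<W : 0# < (coordPower z i * coordNorm z i) * (s^p * Ns^q)
    0<W = *-pos (coordWeight-pos εz)
      (*-pos (^-pos p (Scaling⇒0<s i≢j εz εz′ s σ)) (^-pos q (ι∣∣-pos Ns≢0)))
    rearrange : ∀ xᵢ nᵢ xᵢ′ nᵢ′ x n σ ν →
      xᵢ′ * x * (nᵢ′ * n) * ((xᵢ * nᵢ) * (σ * ν)) ≈
      xᵢ * (x * σ) * (nᵢ * (n * ν)) * (xᵢ′ * nᵢ′)
    rearrange xᵢ nᵢ xᵢ′ nᵢ′ x n σ ν = solve 8 (λ xᵢ nᵢ xᵢ′ nᵢ′ x n σ ν →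
      xᵢ′ :* x :* (nᵢ′ :* n) :* ((xᵢ :* nᵢ) :* (σ :* ν))
      := xᵢ :* (x :* σ) :* (nᵢ :* (n :* ν)) :* (xᵢ′ :* nᵢ′)) refl xᵢ nᵢ xᵢ′ nᵢ′ x n σ ν

  T-avoids : ∀ {i j k z z′ e} (i≢j : i ≢ j) (i≢k : i ≢ k) → k ≢ j →
    T z ↦ z′ → ε z ↦ ((i , j) , i≢j) → ε z′ ↦ e → ¬ SamePair e ((i , k) , i≢k)
  T-avoids {i} {j} {z = z} {z′} i≢j i≢k k≢j (((i₀ , j₀) , i₀≢j₀) , ε₀ , T₀) εz εz′
    with ε-unique {d = (i₀ , j₀) , i₀≢j₀} {(i , j) , i≢j} ε₀ εz
  ... | inj₁ (≡.refl , ≡.refl) =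
    Scaling⇒avoids i≢j i≢k k≢j εz εz′ (Tᵢⱼ⇒Scaling i₀≢j₀ z z′ T₀)
  -- If the step used the opposite orientation, positivity of the image makes coordinate `i`
  -- strictly smaller than coordinate `j`, against membership of `z` in the triangle of (i , j).
  ... | inj₂ (≡.refl , ≡.refl) with Tᵢⱼ⇒Scaling i₀≢j₀ z z′ T₀
  ...   | s , σ = contradiction (Scaling⇒coord< i₀≢j₀ εz εz′ s σ)
                    (half⇒≤ i≢j z (proj₂ (proj₁ εz)))

theorem2p6 : ∀ {c ℓ₁ ℓ₂ ℓ} (ℝ : RealNumbers c ℓ₁ ℓ₂) (F : RealCubicField ℝ ℓ)
    (p q : ℕ) → NonZero p → NonZero q → Coprime p q → ¬ (3 ∣ p) →
    let open Algorithm ℝ F p q in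
    (z : ℕ → K²) → ΔK (z zero) → (∀ n → T z n ↦ z (suc n)) →
    ∀ n (i′ j′ : Fin 3) (i′≢j′ : i′ ≢ j′) (e : Ind) →
    ε z n ↦ ((i′ , j′) , i′≢j′) → ε z (suc n) ↦ e →
    ∀ k → k ≢ i′ → k ≢ j′ → proj₁ e ≢ (i′ , k) × proj₁ e ≢ (k , i′)
theorem2p6 ℝ F p q _ q≢0 _ _ z _ step n i′ j′ i′≢j′ e εz εz′ k k≢i′ k≢j′ =
  -- `SamePair` ignores the inequality proof stored in `e`, so fixing `proj₁ e` suffices.
  (λ where ≡.refl → avoids (inj₁ (≡.refl , ≡.refl))) ,
  (λ where ≡.refl → avoids (inj₂ (≡.refl , ≡.refl)))
  where
  instance
    q-nonZero : NonZero q
    q-nonZero = q≢0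
  open AlgorithmProperties ℝ F p q
  i′≢k : i′ ≢ k
  i′≢k i′≡k = k≢i′ (≡.sym i′≡k)
  avoids : ¬ SamePair e ((i′ , k) , i′≢k)
  avoids = T-avoids i′≢j′ i′≢k k≢j′ (step n) εz εz′
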